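{- For every integer $n\ge1$ and real $x$, $$\frac{\mathfrak{C}_n(x)}{n!}=\det\begin{pmatrix} R(1)&1&&&\\ R(2)&R(1)&1&&\\ \vdots&\vdots&\ddots&\ddots&\\ R(n-1)&R(n-2)&\cdots&R(1)&1\\ R(n)&R(n-1)&\cdots&R(2)&R(1) \end{pmatrix},$$ the $n\times n$ lower Hessenberg matrix with entries $R(i-j+1)$ for $i\ge j$, $1$ on the superdiagonal and $0$ elsewhere, where $$R(j)=x\,\frac{(-1)^{j-1}}{j!}\left(\left(\tfrac12\right)^j-\left(-\tfrac12\right)^j\right).$$
   Context: For $n\ge1$ the central factorial is $x^{[n]}=x\,(x+\tfrac n2-1)(x+\tfrac n2-2)\cdots(x-\tfrac n2+1)$ (a product of $n$ factors), and $x^{[0]}=1$. The central factorial numbers of the second kind $T(n,k)$ ($0\le k\le n$) are defined by $x^n=\sum_{k=0}^n T(n,k)\,x^{[k]}$; equivalently $T(n,k)=\frac1{k!}\sum_{j=0}^k(-1)^j\binom kj\left(\frac k2-j\right)^n$, and $T(n,k)=0$ for $k>n$. The $n$th central Fubini-like polynomial is $\mathfrak{C}_n(x)=\sum_{k=0}^n k!\,T(n,k)\,x^k$. -}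

module Defs where

open import Algebra.Bundles using (CommutativeRing; Semiring)
import Algebra.Definitions.RawSemiring as RawSemiringDefs
open import Data.Bool.Base using (if_then_else_)
open import Data.Fin.Base using (Fin; zero; suc; toℕ; punchIn)
open import Data.Integer.Base using (+_)
open import Data.Nat.Base using (ℕ; zero; suc; _!) renaming (_∸_ to _∸ℕ_; _<_ to _<ℕ_)
open import Data.Nat.Properties using (_≤?_; _≟_; _!≢0)
open import Data.Rational.Base using (ℚ; _+_; _*_; _-_; -_; _/_; 0ℚ; 1ℚ; ½; -½; +-*-rawSemiring)
open import Relation.Binary.PropositionalEquality using (_≡_)
open import Relation.Nullary.Decidable using (does)

private
  module ℚDefs = RawSemiringDefs +-*-rawSemiring

open ℚDefs using (_^_; sum; product)

fromℕ : ℕ → ℚ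
fromℕ n = + n / 1

infixl 8 _^[_]

-- x^[n] = x (x + n/2 - 1) (x + n/2 - 2) ⋯ (x - n/2 + 1); the last factor is
-- x + n/2 - (n-1), so for n = m + 1 there are m factors after the leading x.
_^[_] : ℚ → ℕ → ℚ
x ^[ zero ]  = 1ℚ
x ^[ suc m ] = x * product {m} λ i → x + (+ suc m / 2) - fromℕ (suc (toℕ i))

-- Two polynomials over ℚ coincide iff their values at all rationals do, so
-- the defining expansion of the T(n,k) is stated pointwise.
record IsCentralFactorialNumbers (T : ℕ → ℕ → ℚ) : Set where
  field
    expansion : ∀ n x → x ^ n ≡ sum {suc n} λ k → T n (toℕ k) * x ^[ toℕ k ]
    vanishing : ∀ {n k} → n <ℕ k → T n k ≡ 0ℚ

1/_! : ℕ → ℚ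
1/ n ! = (+ 1 / (n !)) {{n !≢0}}

module Determinant {c ℓ} (A : CommutativeRing c ℓ) where

  open CommutativeRing A using (Carrier; semiring; 1#) renaming (_*_ to _*ᴬ_; -_ to -ᴬ_)
  open RawSemiringDefs (Semiring.rawSemiring semiring) using () renaming (sum to sumᴬ; _^_ to _^ᴬ_)

  Matrix : ℕ → Set c
  Matrix n = Fin n → Fin n → Carrier

  -- Laplace expansion along the first row.
  det : ∀ {n} → Matrix n → Carrier
  det {zero}  M = 1#
  det {suc n} M = sumᴬ λ j →
    (-ᴬ 1#) ^ᴬ toℕ j *ᴬ (M zero j *ᴬ det λ i k → M (suc i) (punchIn j k))

-- ι carries the rational scalars and is meant to be a ring homomorphism, making
-- A a commutative ℚ-algebra; A = ℝ with the inclusion ℚ ⊆ ℝ is the main instance.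
module RationalScalars {c ℓ} (A : CommutativeRing c ℓ)
                       (ι : ℚ → CommutativeRing.Carrier A) where

  open CommutativeRing A using (Carrier; semiring; 0#; 1#) renaming (_*_ to _*ᴬ_)
  open RawSemiringDefs (Semiring.rawSemiring semiring) using () renaming (sum to sumᴬ; _^_ to _^ᴬ_)
  open Determinant A using (Matrix)

  centralFubini : (T : ℕ → ℕ → ℚ) → ℕ → Carrier → Carrier
  centralFubini T n x =
    sumᴬ {suc n} λ k → ι (fromℕ (toℕ k !) * T n (toℕ k)) *ᴬ x ^ᴬ toℕ k

  -- Only meaningful for j ≥ 1, which is all that hessenberg uses.
  R : Carrier → ℕ → Carrier
  R x j = x *ᴬ ι ((- 1ℚ) ^ (j ∸ℕ 1) * 1/ j ! * (½ ^ j - -½ ^ j))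

  -- Indices start at 0, which leaves i - j unchanged.
  hessenberg : (n : ℕ) → Carrier → Matrix n
  hessenberg n x i j =
    if does (toℕ j ≤? toℕ i) then R x (suc (toℕ i ∸ℕ toℕ j))
    else if does (toℕ j ≟ suc (toℕ i)) then 1#
    else 0#

{-# OPTIONS --safe #-}

-- Put cₙₖ = k! T(n,k) / n! and bₖ(x) = x^[k] / k!, so that xⁿ/n! = Σₖ cₙₖ bₖ(x).
-- The central difference δF(x) = F(x + ½) - F(x - ½) lowers the index, δbₖ₊₁ = bₖ,
-- and, by the binomial theorem, δ(xⁿ/n!) = Σⱼ fⱼ xⁿ⁻ʲ/(n-j)! with
-- fⱼ = (½ʲ - (-½)ʲ) / j!, the Taylor coefficients of 2 sinh(t/2).  The bₖ are linearly
-- independent, so cₙ,ₖ₊₁ = Σⱼ fⱼ cₙ₋ⱼ,ₖ, that is, aₙ = ℭₙ(x)/n! satisfies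
-- aₙ = x Σ_{j≥1} fⱼ aₙ₋ⱼ.  Expanding the Hessenberg determinant along its first row
-- gives Dₙ = Σ_{j≥1} (-1)ʲ⁻¹ R(j) Dₙ₋ⱼ, which is the same recurrence.

module Submission where

open import Defs
open import Algebra.Bundles using (CommutativeRing)
open import Algebra.Morphism.Structures using (module RingMorphisms)
import Algebra.Properties.CommutativeMonoid.Sum as CommutativeMonoidSum
import Algebra.Properties.CommutativeSemigroup as CommutativeSemigroupProperties
import Algebra.Properties.CommutativeSemiring.Binomial as Binomial
import Algebra.Properties.Ring as RingProperties
import Algebra.Properties.Semiring.Exp as Exp
import Algebra.Properties.Semiring.Mult as Mult
import Algebra.Properties.Semiring.Sum as Sum
open import Data.Fin.Base using (Fin; zero; suc; toℕ; punchIn)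
open import Data.Fin.Properties using (toℕ≤pred[n]; toℕ-inject₁; toℕ-fromℕ)
import Data.Integer.Base as ℤ
import Data.Integer.Properties as ℤ
open import Data.Nat.Base as ℕ using (ℕ; zero; suc; _≤_; _<_; z≤n; s≤s; _∸_; _!; NonZero)
open import Data.Nat.Combinatorics using (_C_; nCk≡n!/k![n-k]!; k![n∸k]!∣n!)
open import Data.Nat.DivMod using (m/n*n≡m)
import Data.Nat.Properties as ℕ
open import Data.Rational.Base using (ℚ; 0ℚ; 1ℚ; ½; -½; fromℚᵘ; toℚᵘ; +-*-rawRing)
open import Data.Rational.Properties hiding (_≤?_)
open import Data.Rational.Solver using (module +-*-Solver)
open import Data.Rational.Unnormalised.Base as ℚᵘ using (mkℚᵘ; *≡*)
import Data.Rational.Unnormalised.Properties as ℚᵘ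
open import Relation.Binary.PropositionalEquality
  using (_≡_; refl; sym; trans; cong; cong₂; module ≡-Reasoning)

private
  module ℚR = CommutativeRing +-*-commutativeRing
  module ℚS = Sum ℚR.semiring
  module ℚP = CommutativeMonoidSum ℚR.*-commutativeMonoid

-- Finite sums with vanishing terms.

module FiniteSums {c ℓ} (A : CommutativeRing c ℓ) where
  private module A = CommutativeRing A
  open A using (Carrier; _≈_; 0#; semiring)
  private module S = Sum semiring

  sum-zero : ∀ {n} (f : Fin n → Carrier) → (∀ i → f i ≈ 0#) → S.sum f ≈ 0#
  sum-zero {n} f f≈0 = A.trans (S.sum-cong-≋ f≈0) (S.sum-replicate-zero n)

  -- Lets expansions of different degrees be padded to a common number of terms, so that they can be
  -- compared and double sums can be interchanged.
  sum-truncate : ∀ {m n} → m ≤ n → (f : ℕ → Carrier) → (∀ k → m ≤ k → f k ≈ 0#) →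
                 S.sum {n} (λ k → f (toℕ k)) ≈ S.sum {m} (λ k → f (toℕ k))
  sum-truncate {n = n} z≤n f f≈0 = sum-zero {n} (λ i → f (toℕ i)) (λ i → f≈0 (toℕ i) z≤n)
  sum-truncate (s≤s m≤n) f f≈0 =
    A.+-congˡ (sum-truncate m≤n (λ k → f (suc k)) (λ k m≤k → f≈0 (suc k) (s≤s m≤k)))

module CentralFactorials where
  open import Data.Rational.Base using (_+_; _*_; _-_; _/_)
  open Exp ℚR.semiring using (_^_)
  open Mult ℚR.semiring using (_×_)
  open ℚS using (sum; ∑-comm; sum-cong-≗; *-distribˡ-sum; *-distribʳ-sum)
  open ℚP using () renaming (sum to product)
  open FiniteSums +-*-commutativeRing

  -- Rational arithmetic of naturals and reciprocal factorials.

  fromℚᵘ-homo-+ : ∀ p q → fromℚᵘ (p ℚᵘ.+ q) ≡ fromℚᵘ p + fromℚᵘ q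
  -- Reduction to lowest terms blocks direct computation; in the unnormalised rationals both sides
  -- are equivalent to `p ℚᵘ.+ q`.
  fromℚᵘ-homo-+ p q = toℚᵘ-injective (begin
    toℚᵘ (fromℚᵘ (p ℚᵘ.+ q))                 ≈⟨ toℚᵘ-fromℚᵘ (p ℚᵘ.+ q) ⟩
    p ℚᵘ.+ q                                 ≈⟨ ℚᵘ.+-cong (toℚᵘ-fromℚᵘ p) (toℚᵘ-fromℚᵘ q) ⟨
    toℚᵘ (fromℚᵘ p) ℚᵘ.+ toℚᵘ (fromℚᵘ q)     ≈⟨ toℚᵘ-homo-+ (fromℚᵘ p) (fromℚᵘ q) ⟨
    toℚᵘ (fromℚᵘ p + fromℚᵘ q)               ∎)
    where open import Relation.Binary.Reasoning.Setoid ℚᵘ.≃-setoid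

  fromℚᵘ-homo-* : ∀ p q → fromℚᵘ (p ℚᵘ.* q) ≡ fromℚᵘ p * fromℚᵘ q
  fromℚᵘ-homo-* p q = toℚᵘ-injective (begin
    toℚᵘ (fromℚᵘ (p ℚᵘ.* q))                 ≈⟨ toℚᵘ-fromℚᵘ (p ℚᵘ.* q) ⟩
    p ℚᵘ.* q                                 ≈⟨ ℚᵘ.*-cong (toℚᵘ-fromℚᵘ p) (toℚᵘ-fromℚᵘ q) ⟨
    toℚᵘ (fromℚᵘ p) ℚᵘ.* toℚᵘ (fromℚᵘ q)     ≈⟨ toℚᵘ-homo-* (fromℚᵘ p) (fromℚᵘ q) ⟨
    toℚᵘ (fromℚᵘ p * fromℚᵘ q)               ∎)
    where open import Relation.Binary.Reasoning.Setoid ℚᵘ.≃-setoid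

  fromℕ-homo-+ : ∀ m n → fromℕ (m ℕ.+ n) ≡ fromℕ m + fromℕ n
  fromℕ-homo-+ m n = trans
    -- Adding unnormalised fractions with denominator 1 produces the numerator `m * 1 + n * 1`,
    -- which the rewriting anticipates.
    (cong (_/ 1) (sym (cong₂ ℤ._+_ (ℤ.*-identityʳ (ℤ.+ m)) (ℤ.*-identityʳ (ℤ.+ n)))))
    (fromℚᵘ-homo-+ (mkℚᵘ (ℤ.+ m) 0) (mkℚᵘ (ℤ.+ n) 0))

  fromℕ-homo-* : ∀ m n → fromℕ (m ℕ.* n) ≡ fromℕ m * fromℕ n
  fromℕ-homo-* m n = trans
    (cong (_/ 1) (ℤ.pos-* m n))
    (fromℚᵘ-homo-* (mkℚᵘ (ℤ.+ m) 0) (mkℚᵘ (ℤ.+ n) 0))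

  /≡fromℕ*1/ : ∀ m d .{{_ : NonZero d}} → ℤ.+ m / d ≡ fromℕ m * (ℤ.+ 1 / d)
  /≡fromℕ*1/ m d@(suc d-1) = trans
    (fromℚᵘ-cong {mkℚᵘ (ℤ.+ m) d-1} {mkℚᵘ (ℤ.+ m) 0 ℚᵘ.* mkℚᵘ (ℤ.+ 1) d-1}
      (*≡* (cong₂ ℤ._*_ (sym (ℤ.*-identityʳ (ℤ.+ m))) (cong ℤ.+_ (ℕ.+-identityʳ d)))))
    (fromℚᵘ-homo-* (mkℚᵘ (ℤ.+ m) 0) (mkℚᵘ (ℤ.+ 1) d-1))

  fromℕ*1/≡1 : ∀ d .{{_ : NonZero d}} → fromℕ d * (ℤ.+ 1 / d) ≡ 1ℚ
  fromℕ*1/≡1 d@(suc d-1) = trans (sym (/≡fromℕ*1/ d d))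
    (fromℚᵘ-cong {mkℚᵘ (ℤ.+ d) d-1} {mkℚᵘ (ℤ.+ 1) 0} (*≡* (ℤ.*-comm (ℤ.+ d) (ℤ.+ 1))))

  n!*1/n! : ∀ n → fromℕ (n !) * 1/ n ! ≡ 1ℚ
  n!*1/n! n = fromℕ*1/≡1 (n !) {{n ℕ.!≢0}}

  1/n!-unfold : ∀ n → fromℕ (suc n) * 1/ suc n ! ≡ 1/ n !
  1/n!-unfold n = begin
    s * i′                   ≡⟨ *-identityʳ _ ⟨
    -- Inserting 1 as `f * i` replaces division: `s * f` is the factorial of `suc n`, which cancels
    -- `i′`.
    s * i′ * 1ℚ              ≡⟨ cong (s * i′ *_) (n!*1/n! n) ⟨
    s * i′ * (f * i)
      ≡⟨ solve 4 (λ s i′ f i → s :* i′ :* (f :* i) := s :* f :* i′ :* i) refl s i′ f i ⟩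
    s * f * i′ * i           ≡⟨ cong (λ z → z * i′ * i) (fromℕ-homo-* (suc n) (n !)) ⟨
    fromℕ (suc n !) * i′ * i ≡⟨ cong (_* i) (n!*1/n! (suc n)) ⟩
    1ℚ * i                   ≡⟨ *-identityˡ i ⟩
    i                        ∎
    where
    open ≡-Reasoning
    open +-*-Solver
    s = fromℕ (suc n)
    f = fromℕ (n !)
    i = 1/ n !
    i′ = 1/ suc n !

  ×≡fromℕ* : ∀ n x → n × x ≡ fromℕ n * x
  ×≡fromℕ* zero    x = sym (*-zeroˡ x)
  ×≡fromℕ* (suc n) x = begin
    x + n × x                ≡⟨ cong₂ _+_ (sym (*-identityˡ x)) (×≡fromℕ* n x) ⟩
    1ℚ * x + fromℕ n * x     ≡⟨ *-distribʳ-+ x 1ℚ (fromℕ n) ⟨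
    (1ℚ + fromℕ n) * x       ≡⟨ cong (_* x) (fromℕ-homo-+ 1 n) ⟨
    fromℕ (suc n) * x        ∎
    where open ≡-Reasoning

  -- Divided powers and the binomial theorem.

  dividedPower : ℕ → ℚ → ℚ
  dividedPower n x = x ^ n * 1/ n !

  -- This makes divided powers convolve without binomial coefficients. As before, factorials times
  -- their reciprocals are inserted as 1, and the factorial formula for `n C k` cancels the rest.
  1/n!*nCk : ∀ {n k} → k ≤ n → 1/ n ! * fromℕ (n C k) ≡ 1/ k ! * 1/ (n ∸ k) !
  1/n!*nCk {n} {k} k≤n = begin
    i * b                              ≡⟨ *-identityʳ _ ⟨
    i * b * 1ℚ
      ≡⟨ cong (i * b *_) (cong₂ _*_ (n!*1/n! k) (n!*1/n! (n ∸ k))) ⟨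
    i * b * (f₁ * i₁ * (f₂ * i₂))
      ≡⟨ solve 6 (λ i b f₁ i₁ f₂ i₂ → i :* b :* (f₁ :* i₁ :* (f₂ :* i₂)) := b :* (f₁ :* f₂) :* i :* (i₁ :* i₂))
           refl i b f₁ i₁ f₂ i₂ ⟩
    b * (f₁ * f₂) * i * (i₁ * i₂)      ≡⟨ cong (λ z → z * i * (i₁ * i₂)) fact ⟩
    fromℕ (n !) * i * (i₁ * i₂)        ≡⟨ cong (_* (i₁ * i₂)) (n!*1/n! n) ⟩
    1ℚ * (i₁ * i₂)                     ≡⟨ *-identityˡ _ ⟩
    i₁ * i₂                            ∎
    where
    open ≡-Reasoning
    open +-*-Solver
    i = 1/ n !
    b = fromℕ (n C k)
    f₁ = fromℕ (k !)
    i₁ = 1/ k !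
    f₂ = fromℕ ((n ∸ k) !)
    i₂ = 1/ (n ∸ k) !
    instance
      _ = k ℕ.!* (n ∸ k) !≢0
    fact : b * (f₁ * f₂) ≡ fromℕ (n !)
    fact = begin
      b * (f₁ * f₂)                         ≡⟨ cong (b *_) (fromℕ-homo-* (k !) ((n ∸ k) !)) ⟨
      b * fromℕ (k ! ℕ.* (n ∸ k) !)         ≡⟨ fromℕ-homo-* (n C k) _ ⟨
      fromℕ ((n C k) ℕ.* (k ! ℕ.* (n ∸ k) !))
        ≡⟨ cong (λ z → fromℕ (z ℕ.* (k ! ℕ.* (n ∸ k) !))) (nCk≡n!/k![n-k]! k≤n) ⟩
      fromℕ (n ! ℕ./ (k ! ℕ.* (n ∸ k) !) ℕ.* (k ! ℕ.* (n ∸ k) !))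
        ≡⟨ cong fromℕ (m/n*n≡m (k![n∸k]!∣n! k≤n)) ⟩
      fromℕ (n !)                           ∎

  dividedPower-+ : ∀ n x y → dividedPower n (x + y) ≡
                   sum {suc n} λ k → dividedPower (toℕ k) x * dividedPower (n ∸ toℕ k) y
  dividedPower-+ n x y = begin
    (x + y) ^ n * 1/ n !                          ≡⟨ cong (_* 1/ n !) (theorem n x y) ⟩
    binomialExpansion x y n * 1/ n !              ≡⟨ *-distribʳ-sum (1/ n !) (binomialTerm x y n) ⟩
    (sum {suc n} λ k → binomialTerm x y n k * 1/ n !)  ≡⟨ sum-cong-≗ {suc n} term ⟩
    _                                             ∎
    where
    open ≡-Reasoning
    open +-*-Solver
    open Binomial ℚR.commutativeSemiring
    term : (k : Fin (suc n)) → binomialTerm x y n k * 1/ n ! ≡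
           dividedPower (toℕ k) x * dividedPower (n ∸ toℕ k) y
    term k = begin
      (n C toℕ k) × (p * q) * 1/ n !           ≡⟨ cong (_* 1/ n !) (×≡fromℕ* (n C toℕ k) (p * q)) ⟩
      fromℕ (n C toℕ k) * (p * q) * 1/ n !
        ≡⟨ solve 4 (λ b p q i → b :* (p :* q) :* i := p :* q :* (i :* b))
             refl (fromℕ (n C toℕ k)) p q (1/ n !) ⟩
      p * q * (1/ n ! * fromℕ (n C toℕ k))     ≡⟨ cong (p * q *_) (1/n!*nCk (toℕ≤pred[n] k)) ⟩
      p * q * (1/ toℕ k ! * 1/ (n ∸ toℕ k) !)
        ≡⟨ solve 4 (λ p q i j → p :* q :* (i :* j) := p :* i :* (q :* j))
             refl p q (1/ toℕ k !) (1/ (n ∸ toℕ k) !) ⟩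
      dividedPower (toℕ k) x * dividedPower (n ∸ toℕ k) y ∎
      where
      p = x ^ toℕ k
      q = y ^ (n ∸ toℕ k)

  -- The central difference of divided powers.

  δ : (ℚ → ℚ) → ℚ → ℚ
  δ F x = F (½ + x) - F (-½ + x)

  δ-sum : ∀ n (a : ℕ → ℚ) (F : ℕ → ℚ → ℚ) x →
          δ (λ y → sum {n} λ k → a (toℕ k) * F (toℕ k) y) x ≡ sum {n} λ k → a (toℕ k) * δ (F (toℕ k)) x
  δ-sum zero    a F x = refl
  δ-sum (suc n) a F x = begin
    (a 0 * F 0 x⁺ + s⁺) - (a 0 * F 0 x⁻ + s⁻)
      ≡⟨ solve 5 (λ a p q s t → (a :* p :+ s) :- (a :* q :+ t) := a :* (p :- q) :+ (s :- t))
           refl (a 0) (F 0 x⁺) (F 0 x⁻) s⁺ s⁻ ⟩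
    a 0 * δ (F 0) x + (s⁺ - s⁻)
      ≡⟨ cong (a 0 * δ (F 0) x +_) (δ-sum n (λ k → a (suc k)) (λ k → F (suc k)) x) ⟩
    _ ∎
    where
    open ≡-Reasoning
    open +-*-Solver
    x⁺ = ½ + x
    x⁻ = -½ + x
    s⁺ = sum {n} λ k → a (suc (toℕ k)) * F (suc (toℕ k)) x⁺
    s⁻ = sum {n} λ k → a (suc (toℕ k)) * F (suc (toℕ k)) x⁻

  sinhCoeff : ℕ → ℚ
  sinhCoeff j = 1/ j ! * (½ ^ j - -½ ^ j)

  δ-dividedPower : ∀ n x → δ (dividedPower (suc n)) x ≡
                   sum {suc n} λ j → sinhCoeff (suc (toℕ j)) * dividedPower (n ∸ toℕ j) x
  δ-dividedPower n x = begin
    δ (dividedPower (suc n)) x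
      -- Since `δ` writes the shift as the first summand, the index k counts powers of `½` or `-½`,
      -- and both expansions share the factors `e k`.
      ≡⟨ cong₂ _-_ (dividedPower-+ (suc n) ½ x) (dividedPower-+ (suc n) -½ x) ⟩
    (sum {suc (suc n)} λ k → dividedPower (toℕ k) ½ * e (toℕ k))
      - (sum {suc (suc n)} λ k → dividedPower (toℕ k) -½ * e (toℕ k))
      ≡⟨ combine (suc (suc n)) (λ k → dividedPower k ½) (λ k → dividedPower k -½) e ⟩
    (dividedPower 0 ½ - dividedPower 0 -½) * e 0
      + (sum {suc n} λ j → (dividedPower (suc (toℕ j)) ½ - dividedPower (suc (toℕ j)) -½) * e (suc (toℕ j)))
      -- The term for k = 0 drops out because both zeroth divided powers are 1; this is why the
      -- remaining indices start at 1 and the degree falls to n.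
      ≡⟨ cong₂ _+_ (*-zeroˡ (e 0)) (sum-cong-≗ {suc n} λ j → cong (_* e (suc (toℕ j))) (factor (suc (toℕ j)))) ⟩
    0ℚ + (sum {suc n} λ j → sinhCoeff (suc (toℕ j)) * e (suc (toℕ j))) ≡⟨ +-identityˡ _ ⟩
    _ ∎
    where
    open ≡-Reasoning
    open +-*-Solver
    e : ℕ → ℚ
    e k = dividedPower (suc n ∸ k) x
    factor : ∀ j → dividedPower j ½ - dividedPower j -½ ≡ sinhCoeff j
    factor j = solve 3 (λ p q i → p :* i :- q :* i := i :* (p :- q)) refl (½ ^ j) (-½ ^ j) (1/ j !)
    combine : ∀ m (f g h : ℕ → ℚ) →
      (sum {m} λ k → f (toℕ k) * h (toℕ k)) - (sum {m} λ k → g (toℕ k) * h (toℕ k)) ≡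
      sum {m} λ k → (f (toℕ k) - g (toℕ k)) * h (toℕ k)
    combine zero    f g h = refl
    combine (suc m) f g h = trans
      (solve 5 (λ a b c s t → (a :* c :+ s) :- (b :* c :+ t) := (a :- b) :* c :+ (s :- t))
           refl (f 0) (g 0) (h 0) _ _)
      (cong ((f 0 - g 0) * h 0 +_) (combine m (λ k → f (suc k)) (λ k → g (suc k)) (λ k → h (suc k))))

  -- The central difference of central factorials.

  half-suc : ∀ n → ℤ.+ suc n / 2 ≡ ½ + ℤ.+ n / 2
  half-suc n = begin
    ℤ.+ suc n / 2              ≡⟨ /≡fromℕ*1/ (suc n) 2 ⟩
    fromℕ (suc n) * ½          ≡⟨ cong (_* ½) (fromℕ-homo-+ 1 n) ⟩
    (1ℚ + fromℕ n) * ½         ≡⟨ *-distribʳ-+ ½ 1ℚ (fromℕ n) ⟩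
    ½ + fromℕ n * ½            ≡⟨ cong (½ +_) (/≡fromℕ*1/ n 2) ⟨
    ½ + ℤ.+ n / 2              ∎
    where open ≡-Reasoning

  -- For n = m + 1, both shifted products contain `P`, the product of all factors of `x ^[ suc m ]`
  -- except the leading x. The upper shift has one extra factor at the start of its product, the
  -- lower shift one at the end. With `P` taken out and `h″` written as ½ + u/2, what remains is (x
  -- + ½)(x + u/2) - (x - ½)(x - u/2) = (1 + u) x.
  δ-centralFactorial : ∀ n x → δ (_^[ suc n ]) x ≡ fromℕ (suc n) * x ^[ n ]
  δ-centralFactorial zero    x =
    solve 1 (λ x → (con ½ :+ x) :* con 1ℚ :- (con -½ :+ x) :* con 1ℚ := con 1ℚ :* con 1ℚ) refl x
    where open +-*-Solver
  δ-centralFactorial (suc m) x = begin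
    (½ + x) * ((½ + x + h″ - 1ℚ) * product {m} (λ i → ½ + x + h″ - fromℕ (suc (suc (toℕ i)))))
      - (-½ + x) * product {suc m} t
      ≡⟨ cong₂ (λ p q → (½ + x) * ((½ + x + h″ - 1ℚ) * p) - (-½ + x) * q) (ℚP.sum-cong-≗ {m} upper) lower ⟩
    (½ + x) * ((½ + x + h″ - 1ℚ) * P) - (-½ + x) * (P * (-½ + x + h″ - u))
      ≡⟨ cong (λ z → (½ + x) * ((½ + x + z - 1ℚ) * P) - (-½ + x) * (P * (-½ + x + z - u)))
           (trans (half-suc (suc m)) (cong (½ +_) (/≡fromℕ*1/ (suc m) 2))) ⟩
    (½ + x) * ((½ + x + (½ + u * ½) - 1ℚ) * P) - (-½ + x) * (P * (-½ + x + (½ + u * ½) - u))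
      ≡⟨ solve 3 (λ x u P → (con ½ :+ x) :* ((con ½ :+ x :+ (con ½ :+ u :* con ½) :- con 1ℚ) :* P)
                            :- (con -½ :+ x) :* (P :* (con -½ :+ x :+ (con ½ :+ u :* con ½) :- u))
                         := (con 1ℚ :+ u) :* (x :* P)) refl x u P ⟩
    (1ℚ + u) * (x * P)
      ≡⟨ cong (_* (x * P)) (fromℕ-homo-+ 1 (suc m)) ⟨
    fromℕ (suc (suc m)) * x ^[ suc m ] ∎
    where
    open ≡-Reasoning
    open +-*-Solver
    u = fromℕ (suc m)
    h′ = ℤ.+ suc m / 2
    h″ = ℤ.+ suc (suc m) / 2
    t : Fin (suc m) → ℚ
    t i = -½ + x + h″ - fromℕ (suc (toℕ i))
    P = product {m} λ i → x + h′ - fromℕ (suc (toℕ i))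
    upper : (i : Fin m) → ½ + x + h″ - fromℕ (suc (suc (toℕ i))) ≡ x + h′ - fromℕ (suc (toℕ i))
    upper i = trans
      (cong₂ (λ p q → ½ + x + p - q) (half-suc (suc m)) (fromℕ-homo-+ 1 (suc (toℕ i))))
      (solve 3 (λ x h k → con ½ :+ x :+ (con ½ :+ h) :- (con 1ℚ :+ k) := x :+ h :- k)
           refl x h′ (fromℕ (suc (toℕ i))))
    lower : product {suc m} t ≡ P * (-½ + x + h″ - u)
    lower = trans (ℚP.sum-init-last {m} t) (cong₂ _*_
      (ℚP.sum-cong-≗ {m} λ i → trans
        (cong₂ (λ p q → -½ + x + p - fromℕ (suc q)) (half-suc (suc m)) (toℕ-inject₁ i))
        (solve 3 (λ x h k → con -½ :+ x :+ (con ½ :+ h) :- k := x :+ h :- k)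
             refl x h′ (fromℕ (suc (toℕ i)))))
      (cong (λ q → -½ + x + h″ - fromℕ (suc q)) (toℕ-fromℕ m)))

  dividedCentral : ℕ → ℚ → ℚ
  dividedCentral k x = 1/ k ! * x ^[ k ]

  dividedCentral-0 : ∀ k → dividedCentral (suc k) 0ℚ ≡ 0ℚ
  dividedCentral-0 k = trans
    (cong (1/ suc k ! *_) (*-zeroˡ (product {k} λ i → 0ℚ + (ℤ.+ suc k / 2) - fromℕ (suc (toℕ i)))))
    (*-zeroʳ (1/ suc k !))

  δ-dividedCentral : ∀ k x → δ (dividedCentral (suc k)) x ≡ dividedCentral k x
  δ-dividedCentral k x = begin
    i * (½ + x) ^[ suc k ] - i * (-½ + x) ^[ suc k ]
      ≡⟨ solve 3 (λ i p q → i :* p :- i :* q := i :* (p :- q))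
           refl i ((½ + x) ^[ suc k ]) ((-½ + x) ^[ suc k ]) ⟩
    i * δ (_^[ suc k ]) x                ≡⟨ cong (i *_) (δ-centralFactorial k x) ⟩
    i * (fromℕ (suc k) * x ^[ k ])
      ≡⟨ solve 3 (λ i s p → i :* (s :* p) := s :* i :* p) refl i (fromℕ (suc k)) (x ^[ k ]) ⟩
    fromℕ (suc k) * i * x ^[ k ]         ≡⟨ cong (_* x ^[ k ]) (1/n!-unfold k) ⟩
    dividedCentral k x                   ∎
    where
    open ≡-Reasoning
    open +-*-Solver
    i = 1/ suc k !

  -- Linear independence of the divided central factorials.

  series : ℕ → (ℕ → ℚ) → ℚ → ℚ
  series N a x = sum {N} λ k → a (toℕ k) * dividedCentral (toℕ k) x

  series-0 : ∀ N a → series (suc N) a 0ℚ ≡ a 0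
  series-0 N a = begin
    a 0 * 1ℚ + _  ≡⟨ cong₂ _+_ (*-identityʳ (a 0)) (sum-zero {N} _ λ k →
                       trans (cong (a (suc (toℕ k)) *_) (dividedCentral-0 (toℕ k))) (*-zeroʳ (a (suc (toℕ k))))) ⟩
    a 0 + 0ℚ      ≡⟨ +-identityʳ (a 0) ⟩
    a 0           ∎
    where open ≡-Reasoning

  δ-series : ∀ N a x → δ (series (suc N) a) x ≡ series N (λ k → a (suc k)) x
  δ-series N a x = begin
    δ (series (suc N) a) x
      ≡⟨ δ-sum (suc N) a dividedCentral x ⟩
    a 0 * (1ℚ - 1ℚ) + (sum {N} λ k → a (suc (toℕ k)) * δ (dividedCentral (suc (toℕ k))) x)
      ≡⟨ cong₂ _+_ (*-zeroʳ (a 0)) (sum-cong-≗ {N} λ k → cong (a (suc (toℕ k)) *_) (δ-dividedCentral (toℕ k) x)) ⟩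
    0ℚ + series N (λ k → a (suc k)) x   ≡⟨ +-identityˡ _ ⟩
    series N (λ k → a (suc k)) x        ∎
    where open ≡-Reasoning

  -- Evaluation at 0 gives the constant coefficient, and δ shifts the others down.
  series-injective : ∀ N a b → (∀ x → series N a x ≡ series N b x) → ∀ {k} → k < N → a k ≡ b k
  series-injective (suc N) a b eq {zero}  _         =
    trans (sym (series-0 N a)) (trans (eq 0ℚ) (series-0 N b))
  series-injective (suc N) a b eq {suc k} (s≤s k<N) =
    series-injective N (λ k → a (suc k)) (λ k → b (suc k))
      (λ x → trans (sym (δ-series N a x)) (trans (cong₂ _-_ (eq (½ + x)) (eq (-½ + x))) (δ-series N b x)))
      k<N

  -- Recurrence for the scaled central factorial numbers.

  module CentralNumbers (T : ℕ → ℕ → ℚ) (isCFN : IsCentralFactorialNumbers T) where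
    open IsCentralFactorialNumbers isCFN

    coeff : ℕ → ℕ → ℚ
    coeff n k = 1/ n ! * (fromℕ (k !) * T n k)

    coeff-vanishing : ∀ n k → n < k → coeff n k ≡ 0ℚ
    coeff-vanishing n k n<k = begin
      1/ n ! * (fromℕ (k !) * T n k) ≡⟨ cong (λ z → 1/ n ! * (fromℕ (k !) * z)) (vanishing n<k) ⟩
      1/ n ! * (fromℕ (k !) * 0ℚ)    ≡⟨ cong (1/ n ! *_) (*-zeroʳ (fromℕ (k !))) ⟩
      1/ n ! * 0ℚ                    ≡⟨ *-zeroʳ (1/ n !) ⟩
      0ℚ                             ∎
      where open ≡-Reasoning

    -- The length N is left free above n because powers of different degrees must later be expanded
    -- over the same range; the extra coefficients vanish.
    dividedPower-series : ∀ {n N} → n < N → ∀ x → dividedPower n x ≡ series N (coeff n) x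
    dividedPower-series {n} {N} n<N x = begin
      x ^ n * 1/ n !                                         ≡⟨ cong (_* 1/ n !) (expansion n x) ⟩
      (sum {suc n} λ k → T n (toℕ k) * x ^[ toℕ k ]) * 1/ n !
        ≡⟨ *-distribʳ-sum (1/ n !) (λ (k : Fin (suc n)) → T n (toℕ k) * x ^[ toℕ k ]) ⟩
      (sum {suc n} λ k → T n (toℕ k) * x ^[ toℕ k ] * 1/ n !)
        ≡⟨ sum-cong-≗ {suc n} (λ k → term (toℕ k)) ⟩
      series (suc n) (coeff n) x
        ≡⟨ sum-truncate n<N (λ k → coeff n k * dividedCentral k x)
             (λ k n<k → trans (cong (_* dividedCentral k x) (coeff-vanishing n k n<k))
                        (*-zeroˡ (dividedCentral k x))) ⟨
      series N (coeff n) x ∎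
      where
      open ≡-Reasoning
      open +-*-Solver
      term : ∀ k → T n k * x ^[ k ] * 1/ n ! ≡ coeff n k * dividedCentral k x
      term k = begin
        T n k * x ^[ k ] * 1/ n !                            ≡⟨ *-identityˡ _ ⟨
        1ℚ * (T n k * x ^[ k ] * 1/ n !)
          -- The inserted 1 is split: k! goes into `coeff`, its reciprocal into `dividedCentral`.
          ≡⟨ cong (_* (T n k * x ^[ k ] * 1/ n !)) (n!*1/n! k) ⟨
        fromℕ (k !) * 1/ k ! * (T n k * x ^[ k ] * 1/ n !)
          ≡⟨ solve 5 (λ f i t p j → f :* i :* (t :* p :* j) := j :* (f :* t) :* (i :* p))
               refl (fromℕ (k !)) (1/ k !) (T n k) (x ^[ k ]) (1/ n !) ⟩
        coeff n k * dividedCentral k x                       ∎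

    -- At the point 0 only the constant basis element survives, and the zeroth divided power
    -- computes to 1.
    coeff-00 : coeff 0 0 ≡ 1ℚ
    coeff-00 = trans (sym (series-0 0 (coeff 0))) (sym (dividedPower-series {0} {1} (s≤s z≤n) 0ℚ))

    coeff-suc-0 : ∀ n → coeff (suc n) 0 ≡ 0ℚ
    coeff-suc-0 n = begin
      coeff (suc n) 0                             ≡⟨ series-0 (suc n) (coeff (suc n)) ⟨
      series (suc (suc n)) (coeff (suc n)) 0ℚ
        ≡⟨ dividedPower-series (ℕ.≤-refl {suc (suc n)}) 0ℚ ⟨
      0ℚ * 0ℚ ^ n * 1/ suc n !                    ≡⟨ cong (_* 1/ suc n !) (*-zeroˡ (0ℚ ^ n)) ⟩
      0ℚ * 1/ suc n !                             ≡⟨ *-zeroˡ (1/ suc n !) ⟩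
      0ℚ                                          ∎
      where open ≡-Reasoning

    -- Both sides are the coefficient of `dividedCentral k` in `δ (dividedPower (suc n))`: on the
    -- left `δ` shifts the expansion, on the right `δ` is applied first and the resulting lower
    -- powers are expanded.
    coeff-suc-suc : ∀ n {k} → k ≤ n →
      coeff (suc n) (suc k) ≡ sum {suc n} λ j → sinhCoeff (suc (toℕ j)) * coeff (n ∸ toℕ j) k
    coeff-suc-suc n k≤n = series-injective (suc n)
      (λ k → coeff (suc n) (suc k)) (λ k → sum {suc n} λ j → s j * coeff (n ∸ toℕ j) k) same (s≤s k≤n)
      where
      open ≡-Reasoning
      s : Fin (suc n) → ℚ
      s j = sinhCoeff (suc (toℕ j))
      same : ∀ x → series (suc n) (λ k → coeff (suc n) (suc k)) x ≡
                   series (suc n) (λ k → sum {suc n} λ j → s j * coeff (n ∸ toℕ j) k) x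
      same x = begin
        series (suc n) (λ k → coeff (suc n) (suc k)) x   ≡⟨ δ-series (suc n) (coeff (suc n)) x ⟨
        δ (series (suc (suc n)) (coeff (suc n))) x
          ≡⟨ cong₂ _-_ (dividedPower-series (ℕ.≤-refl {suc (suc n)}) (½ + x))
                     (dividedPower-series (ℕ.≤-refl {suc (suc n)}) (-½ + x)) ⟨
        δ (dividedPower (suc n)) x                       ≡⟨ δ-dividedPower n x ⟩
        (sum {suc n} λ j → s j * dividedPower (n ∸ toℕ j) x)
          ≡⟨ sum-cong-≗ {suc n} (λ j → trans
               (cong (s j *_) (dividedPower-series (s≤s (ℕ.m∸n≤m n (toℕ j))) x))
               (*-distribˡ-sum (s j) (λ (k : Fin (suc n)) → coeff (n ∸ toℕ j) (toℕ k) * dividedCentral (toℕ k) x))) ⟩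
        (sum {suc n} λ j → sum {suc n} λ k → s j * (coeff (n ∸ toℕ j) (toℕ k) * dividedCentral (toℕ k) x))
          -- All inner expansions have length n + 1, so the sums can be exchanged to collect the
          -- coefficient of each basis element.
          ≡⟨ ∑-comm {suc n} {suc n} (λ j k → s j * (coeff (n ∸ toℕ j) (toℕ k) * dividedCentral (toℕ k) x)) ⟩
        (sum {suc n} λ k → sum {suc n} λ j → s j * (coeff (n ∸ toℕ j) (toℕ k) * dividedCentral (toℕ k) x))
          ≡⟨ sum-cong-≗ {suc n} (λ k → trans
               (sum-cong-≗ {suc n} (λ j → sym (*-assoc (s j) (coeff (n ∸ toℕ j) (toℕ k)) (dividedCentral (toℕ k) x))))
               (sym (*-distribʳ-sum (dividedCentral (toℕ k) x) (λ j → s j * coeff (n ∸ toℕ j) (toℕ k))))) ⟩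
        series (suc n) (λ k → sum {suc n} λ j → s j * coeff (n ∸ toℕ j) k) x ∎

-- Laplace expansion of the Hessenberg determinant.

module Hessenberg {c ℓ} (A : CommutativeRing c ℓ) (ι : ℚ → CommutativeRing.Carrier A)
                  (x : CommutativeRing.Carrier A) where
  private module A = CommutativeRing A
  open A using (Carrier; _≈_; 0#; 1#) renaming (_+_ to _+ᴬ_; _*_ to _*ᴬ_; -_ to -ᴬ_; _-_ to _-ᴬ_)
  open Exp A.semiring using () renaming (_^_ to _^ᴬ_)
  private module S = Sum A.semiring
  open FiniteSums A
  open Determinant A
  open RationalScalars A ι
  open RingProperties A.ring using (-1*x≈-x)
  open import Relation.Binary.Reasoning.Setoid A.setoid

  -- Matrices are functions, so the minors arising below can only be matched entry by entry.
  det-cong : ∀ {n} {M N : Matrix n} → (∀ i j → M i j ≈ N i j) → det M ≈ det N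
  det-cong {zero}  M≈N = A.refl
  det-cong {suc n} M≈N = S.sum-cong-≋ {suc n} λ j → A.*-congˡ {(-ᴬ 1#) ^ᴬ toℕ j}
    (A.*-cong (M≈N zero j) (det-cong λ i k → M≈N (suc i) (punchIn j k)))

  hessenbergDet : ℕ → Carrier
  hessenbergDet n = det (hessenberg n x)

  -- Deleting row 0 and column 1 leaves a Hessenberg matrix whose first column
  -- is moved on by one index, so the Laplace expansion stays within this family.
  shifted : ℕ → (n : ℕ) → Matrix n
  shifted s n i zero    = R x (suc (s ℕ.+ toℕ i))
  shifted s n i (suc j) = hessenberg n x i (suc j)

  det-shifted-1 : ∀ s → det (shifted s 1) ≈ R x (suc s)
  det-shifted-1 s = begin
    1# *ᴬ (R x (suc (s ℕ.+ 0)) *ᴬ 1#) +ᴬ 0#  ≈⟨ A.+-identityʳ _ ⟩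
    1# *ᴬ (R x (suc (s ℕ.+ 0)) *ᴬ 1#)        ≈⟨ A.*-identityˡ _ ⟩
    R x (suc (s ℕ.+ 0)) *ᴬ 1#                ≈⟨ A.*-identityʳ _ ⟩
    R x (suc (s ℕ.+ 0))                      ≡⟨ cong (λ m → R x (suc m)) (ℕ.+-identityʳ s) ⟩
    R x (suc s)                              ∎

  -- The first row has at most two nonzero entries, `R x (suc s)` and the superdiagonal 1. Deleting
  -- the first column removes the shifted one and leaves an ordinary Hessenberg matrix; deleting the
  -- second keeps it, starting one row lower, which raises s by one.
  det-shifted-suc : ∀ s n → det (shifted s (suc (suc n))) ≈
                    R x (suc s) *ᴬ hessenbergDet (suc n) -ᴬ det (shifted (suc s) (suc n))
  det-shifted-suc s n = A.+-cong first (A.trans (A.+-cong second rest) (A.+-identityʳ _))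
    where
    M = shifted s (suc (suc n))
    first : 1# *ᴬ (M zero zero *ᴬ det (λ i k → M (suc i) (suc k))) ≈ R x (suc s) *ᴬ hessenbergDet (suc n)
    first = A.trans (A.*-identityˡ _) (A.*-cong
      (A.reflexive (cong (λ m → R x (suc m)) (ℕ.+-identityʳ s)))
      -- Entries depend only on i - j; splitting on the column lets the index comparisons compute.
      (det-cong {suc n} {λ i k → M (suc i) (suc k)} {hessenberg (suc n) x} λ where
        i zero    → A.refl
        i (suc k) → A.refl))
    second : (-ᴬ 1# *ᴬ 1#) *ᴬ (1# *ᴬ det (λ i k → M (suc i) (punchIn (suc zero) k))) ≈
             -ᴬ det (shifted (suc s) (suc n))
    second = begin
      (-ᴬ 1# *ᴬ 1#) *ᴬ (1# *ᴬ d)          ≈⟨ A.*-cong (A.*-identityʳ _) (A.*-identityˡ _) ⟩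
      -ᴬ 1# *ᴬ d                          ≈⟨ -1*x≈-x d ⟩
      -ᴬ d
        ≈⟨ A.-‿cong (det-cong {suc n} {minor} {shifted (suc s) (suc n)} λ where
          i zero    → A.reflexive (cong (λ m → R x (suc m)) (ℕ.+-suc s (toℕ i)))
          i (suc k) → A.refl) ⟩
      -ᴬ det (shifted (suc s) (suc n))    ∎
      where
      minor : Matrix (suc n)
      minor i k = M (suc i) (punchIn (suc zero) k)
      d = det minor
    rest : S.sum {n} (λ j →
             (-ᴬ 1#) ^ᴬ suc (suc (toℕ j)) *ᴬ (0# *ᴬ det (λ i k → M (suc i) (punchIn (suc (suc j)) k)))) ≈ 0#
    rest = sum-zero {n} _ λ j → A.trans (A.*-congˡ (A.zeroˡ _)) (A.zeroʳ _)

  -- Iterates the two-term recurrence: each round flips the sign and raises s by one. Induction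
  -- therefore needs arbitrary s, although only s = 0 is wanted in the end.
  det-shifted : ∀ s n → det (shifted s (suc n)) ≈
    S.sum {suc n} λ j → ((-ᴬ 1#) ^ᴬ toℕ j *ᴬ R x (suc (s ℕ.+ toℕ j))) *ᴬ hessenbergDet (n ∸ toℕ j)
  det-shifted s zero    = begin
    det (shifted s 1)                                 ≈⟨ det-shifted-1 s ⟩
    R x (suc s)
      ≡⟨ cong (λ m → R x (suc m)) (ℕ.+-identityʳ s) ⟨
    R x (suc (s ℕ.+ 0))                               ≈⟨ A.*-identityˡ _ ⟨
    1# *ᴬ R x (suc (s ℕ.+ 0))                         ≈⟨ A.*-identityʳ _ ⟨
    (1# *ᴬ R x (suc (s ℕ.+ 0))) *ᴬ 1#                 ≈⟨ A.+-identityʳ _ ⟨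
    (1# *ᴬ R x (suc (s ℕ.+ 0))) *ᴬ 1# +ᴬ 0#           ∎
  det-shifted s (suc n) = begin
    det (shifted s (suc (suc n)))
      ≈⟨ det-shifted-suc s n ⟩
    R x (suc s) *ᴬ D (suc n) -ᴬ det (shifted (suc s) (suc n))
      ≈⟨ A.+-cong (A.*-congʳ (A.trans
           (A.reflexive (cong (λ m → R x (suc m)) (sym (ℕ.+-identityʳ s)))) (A.sym (A.*-identityˡ _))))
         (A.trans (A.-‿cong (det-shifted (suc s) n)) (A.sym (-1*x≈-x _))) ⟩
    (1# *ᴬ R x (suc (s ℕ.+ 0))) *ᴬ D (suc n) +ᴬ -ᴬ 1# *ᴬ S.sum {suc n} (term (suc s))
      ≈⟨ A.+-congˡ (A.trans (S.*-distribˡ-sum (-ᴬ 1#) (term (suc s))) (S.sum-cong-≋ {suc n} shift)) ⟩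
    _ ∎
    where
    D = hessenbergDet
    term : ℕ → Fin (suc n) → Carrier
    term s j = ((-ᴬ 1#) ^ᴬ toℕ j *ᴬ R x (suc (s ℕ.+ toℕ j))) *ᴬ D (n ∸ toℕ j)
    shift : ∀ j → -ᴬ 1# *ᴬ term (suc s) j ≈
            ((-ᴬ 1#) ^ᴬ suc (toℕ j) *ᴬ R x (suc (s ℕ.+ suc (toℕ j)))) *ᴬ D (n ∸ toℕ j)
    shift j = begin
      -ᴬ 1# *ᴬ term (suc s) j     ≈⟨ A.*-assoc _ _ _ ⟨
      (-ᴬ 1# *ᴬ ((-ᴬ 1#) ^ᴬ toℕ j *ᴬ R x (suc (suc s ℕ.+ toℕ j)))) *ᴬ D (n ∸ toℕ j)
        ≈⟨ A.*-congʳ (A.trans (A.sym (A.*-assoc _ _ _))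
             (A.*-congˡ (A.reflexive (cong (λ m → R x (suc m)) (sym (ℕ.+-suc s (toℕ j))))))) ⟩
      _ ∎

  hessenbergDet-suc : ∀ n → hessenbergDet (suc n) ≈
    S.sum {suc n} λ j → ((-ᴬ 1#) ^ᴬ toℕ j *ᴬ R x (suc (toℕ j))) *ᴬ hessenbergDet (n ∸ toℕ j)
  hessenbergDet-suc n = A.trans
    (det-cong {suc n} {hessenberg (suc n) x} {shifted 0 (suc n)} λ where
      i zero    → A.refl
      i (suc j) → A.refl)
    (det-shifted 0 n)

-- Transfer of the rational identities along ι.

module RationalAlgebra {c ℓ} (A : CommutativeRing c ℓ)
    (ι : ℚ → CommutativeRing.Carrier A)
    (isHom : RingMorphisms.IsRingHomomorphism +-*-rawRing (CommutativeRing.rawRing A) ι) where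
  open import Data.Rational.Base using (_+_; _*_; _-_; -_)
  open Exp ℚR.semiring using (_^_)
  open ℚS using (sum)
  open CentralFactorials
  private module A = CommutativeRing A
  open A using (Carrier; _≈_; 0#; 1#) renaming (_+_ to _+ᴬ_; _*_ to _*ᴬ_; -_ to -ᴬ_)
  open Exp A.semiring using () renaming (_^_ to _^ᴬ_)
  private module S = Sum A.semiring
  open FiniteSums A
  open RationalScalars A ι
  open RingMorphisms.IsRingHomomorphism isHom
  open CommutativeSemigroupProperties A.*-commutativeSemigroup using (x∙yz≈y∙xz; interchange)
  open import Relation.Binary.Reasoning.Setoid A.setoid

  ι-cong : ∀ {p q} → p ≡ q → ι p ≈ ι q
  ι-cong p≡q = A.reflexive (cong ι p≡q)

  ι-sum : ∀ {n} (f : Fin n → ℚ) → ι (sum f) ≈ S.sum λ i → ι (f i)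
  ι-sum {zero}  f = 0#-homo
  ι-sum {suc n} f = A.trans (+-homo (f zero) _) (A.+-congˡ (ι-sum λ i → f (suc i)))

  ι-^ : ∀ p n → ι (p ^ n) ≈ ι p ^ᴬ n
  ι-^ p zero    = 1#-homo
  ι-^ p (suc n) = A.trans (*-homo p (p ^ n)) (A.*-congˡ (ι-^ p n))

  -1^n*-1^n : ∀ n → (- 1ℚ) ^ n * (- 1ℚ) ^ n ≡ 1ℚ
  -1^n*-1^n zero    = refl
  -1^n*-1^n (suc n) = trans
    (solve 1 (λ p → con (- 1ℚ) :* p :* (con (- 1ℚ) :* p) := p :* p) refl ((- 1ℚ) ^ n))
    (-1^n*-1^n n)
    where open +-*-Solver

  -- The sign from the Laplace expansion meets the equal sign built into `R`, and their product is
  -- 1.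
  signed-R : ∀ x j → (-ᴬ 1#) ^ᴬ j *ᴬ R x (suc j) ≈ x *ᴬ ι (sinhCoeff (suc j))
  signed-R x j = begin
    (-ᴬ 1#) ^ᴬ j *ᴬ (x *ᴬ ι (e * i * g))
      ≈⟨ A.*-congʳ (A.trans (ι-^ (- 1ℚ) j) (Exp.^-congˡ A.semiring j (A.trans (-‿homo 1ℚ) (A.-‿cong 1#-homo)))) ⟨
    ι e *ᴬ (x *ᴬ ι (e * i * g))    ≈⟨ x∙yz≈y∙xz _ _ _ ⟩
    x *ᴬ (ι e *ᴬ ι (e * i * g))    ≈⟨ A.*-congˡ (*-homo e (e * i * g)) ⟨
    x *ᴬ ι (e * (e * i * g))       ≈⟨ A.*-congˡ (ι-cong (trans
         (solve 3 (λ e i g → e :* (e :* i :* g) := e :* e :* (i :* g)) refl e i g)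
         (trans (cong (_* (i * g)) (-1^n*-1^n j)) (*-identityˡ (i * g))))) ⟩
    x *ᴬ ι (sinhCoeff (suc j))     ∎
    where
    open +-*-Solver
    e = (- 1ℚ) ^ j
    i = 1/ suc j !
    g = ½ ^ suc j - -½ ^ suc j

  -- The common recurrence of scaled Fubini polynomials and determinants.

  module _ (T : ℕ → ℕ → ℚ) (isCFN : IsCentralFactorialNumbers T) (x : Carrier) where
    open CentralNumbers T isCFN
    open Hessenberg A ι x

    fubini/n! : ℕ → Carrier
    fubini/n! n = S.sum {suc n} λ k → ι (coeff n (toℕ k)) *ᴬ x ^ᴬ toℕ k

    fubini/n!-correct : ∀ n → ι (1/ n !) *ᴬ centralFubini T n x ≈ fubini/n! n
    fubini/n!-correct n = A.trans
      (S.*-distribˡ-sum {suc n} (ι (1/ n !)) λ k → ι (fromℕ (toℕ k !) * T n (toℕ k)) *ᴬ x ^ᴬ toℕ k)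
      (S.sum-cong-≋ {suc n} λ k → A.trans (A.sym (A.*-assoc _ _ (x ^ᴬ toℕ k)))
        (A.*-congʳ (A.sym (*-homo (1/ n !) (fromℕ (toℕ k !) * T n (toℕ k))))))

    fubini/n!-truncate : ∀ {m n} → m ≤ n →
      S.sum {suc n} (λ k → ι (coeff m (toℕ k)) *ᴬ x ^ᴬ toℕ k) ≈ fubini/n! m
    fubini/n!-truncate {m} m≤n = sum-truncate (s≤s m≤n) (λ k → ι (coeff m k) *ᴬ x ^ᴬ k) λ k m<k →
      A.trans (A.*-congʳ (A.trans (ι-cong (coeff-vanishing m k m<k)) 0#-homo)) (A.zeroˡ _)

    fubini/n!-suc : ∀ n → fubini/n! (suc n) ≈
      S.sum {suc n} λ j → (x *ᴬ ι (sinhCoeff (suc (toℕ j)))) *ᴬ fubini/n! (n ∸ toℕ j)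
    fubini/n!-suc n = begin
      ι (coeff (suc n) 0) *ᴬ 1# +ᴬ (S.sum {suc n} λ k → ι (coeff (suc n) (suc (toℕ k))) *ᴬ (x *ᴬ p k))
        -- The constant term is zero, so every remaining term carries a factor x, which moves into
        -- the weight `w j`.
        ≈⟨ A.+-cong (A.trans (A.*-identityʳ _) (A.trans (ι-cong (coeff-suc-0 n)) 0#-homo))
                    (S.sum-cong-≋ {suc n} expand) ⟩
      0# +ᴬ (S.sum {suc n} λ k → S.sum {suc n} λ j → w j *ᴬ (q j k *ᴬ p k))
        ≈⟨ A.+-identityˡ _ ⟩
      (S.sum {suc n} λ k → S.sum {suc n} λ j → w j *ᴬ (q j k *ᴬ p k))
        ≈⟨ S.∑-comm {suc n} {suc n} (λ k j → w j *ᴬ (q j k *ᴬ p k)) ⟩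
      (S.sum {suc n} λ j → S.sum {suc n} λ k → w j *ᴬ (q j k *ᴬ p k))
        ≈⟨ S.sum-cong-≋ {suc n} (λ j → A.trans
             (A.sym (S.*-distribˡ-sum {suc n} (w j) (λ k → q j k *ᴬ p k)))
             -- The inner sum still runs over n + 1 terms, beyond the degree `n ∸ toℕ j`; the
             -- surplus is cut off.
             (A.*-congˡ (fubini/n!-truncate (ℕ.m∸n≤m n (toℕ j))))) ⟩
      (S.sum {suc n} λ j → w j *ᴬ fubini/n! (n ∸ toℕ j)) ∎
      where
      p : Fin (suc n) → Carrier
      p k = x ^ᴬ toℕ k
      f w : Fin (suc n) → Carrier
      f j = ι (sinhCoeff (suc (toℕ j)))
      w j = x *ᴬ f j
      q : Fin (suc n) → Fin (suc n) → Carrier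
      q j k = ι (coeff (n ∸ toℕ j) (toℕ k))
      expand : ∀ k → ι (coeff (suc n) (suc (toℕ k))) *ᴬ (x *ᴬ p k) ≈
               S.sum {suc n} λ j → w j *ᴬ (q j k *ᴬ p k)
      expand k = begin
        ι (coeff (suc n) (suc (toℕ k))) *ᴬ (x *ᴬ p k)
          ≈⟨ A.*-congʳ (A.trans (ι-cong (coeff-suc-suc n (toℕ≤pred[n] k)))
               (A.trans (ι-sum {suc n} (λ j → sinhCoeff (suc (toℕ j)) * coeff (n ∸ toℕ j) (toℕ k)))
                 (S.sum-cong-≋ {suc n} λ j → *-homo (sinhCoeff (suc (toℕ j))) (coeff (n ∸ toℕ j) (toℕ k))))) ⟩
        S.sum {suc n} (λ j → f j *ᴬ q j k) *ᴬ (x *ᴬ p k)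
          ≈⟨ S.*-distribʳ-sum {suc n} (x *ᴬ p k) (λ j → f j *ᴬ q j k) ⟩
        (S.sum {suc n} λ j → (f j *ᴬ q j k) *ᴬ (x *ᴬ p k))
          ≈⟨ S.sum-cong-≋ {suc n} (λ j → A.trans (interchange (f j) (q j k) x (p k)) (A.*-congʳ (A.*-comm (f j) x))) ⟩
        (S.sum {suc n} λ j → w j *ᴬ (q j k *ᴬ p k)) ∎

    -- Strong induction on m, since the recurrence reaches all smaller indices. The bound n provides
    -- the structural descent.
    fubini/n!≈hessenbergDet : ∀ n {m} → m ≤ n → fubini/n! m ≈ hessenbergDet m
    fubini/n!≈hessenbergDet n {zero}  _ = begin
      ι (coeff 0 0) *ᴬ 1# +ᴬ 0#  ≈⟨ A.trans (A.+-identityʳ _) (A.*-identityʳ _) ⟩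
      ι (coeff 0 0)              ≈⟨ A.trans (ι-cong coeff-00) 1#-homo ⟩
      1#                         ∎
    fubini/n!≈hessenbergDet (suc n) {suc m} (s≤s m≤n) = begin
      fubini/n! (suc m)
        ≈⟨ fubini/n!-suc m ⟩
      (S.sum {suc m} λ j → (x *ᴬ ι (sinhCoeff (suc (toℕ j)))) *ᴬ fubini/n! (m ∸ toℕ j))
        ≈⟨ S.sum-cong-≋ {suc m} (λ j → A.*-cong (A.sym (signed-R x (toℕ j)))
             (fubini/n!≈hessenbergDet n (ℕ.≤-trans (ℕ.m∸n≤m m (toℕ j)) m≤n))) ⟩
      _
        ≈⟨ hessenbergDet-suc m ⟨
      hessenbergDet (suc m) ∎

theorem10 : ∀ {c ℓ} (A : CommutativeRing c ℓ) (let open CommutativeRing A) →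
    (ι : ℚ → Carrier) → RingMorphisms.IsRingHomomorphism +-*-rawRing rawRing ι →
    (T : ℕ → ℕ → ℚ) → IsCentralFactorialNumbers T →
    (n : ℕ) → 1 ≤ n → (x : Carrier) →
    ι (1/ n !) * RationalScalars.centralFubini A ι T n x
    ≈ Determinant.det A (RationalScalars.hessenberg A ι n x)
theorem10 A ι isHom T isCFN n _ x = CommutativeRing.trans A
  (fubini/n!-correct T isCFN x n) (fubini/n!≈hessenbergDet T isCFN x n ℕ.≤-refl)
  where open RationalAlgebra A ι isHom
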